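{- Let $\mathbf{B} = (B; \cap, \cup, ', 0, 1)$ be a Boolean algebra. Then the contract algebra $\mathbf{C(B)} = (C(B); \wedge, \vee, \neg, D, \bot, \gamma, \top)$ on $\mathbf{B}$ is a c3dp-algebra (with bottom $\bot$, top $\top$ and distinguished constant $c=\gamma$).
   Context: Contract algebra on $\mathbf{B}$: $C(B) = \{(a,b) \in B\times B : a \cup b = 1\}$, with operations $(a,b)\wedge(c,d) = (a\cup c, b\cap d)$, $(a,b)\vee(c,d) = (a\cap c, b\cup d)$, $\neg(a,b) = (b,b')$, $D(a,b) = (a',a)$, $\bot = (1,0)$, $\gamma = (1,1)$, $\top=(0,1)$. A dp-algebra (double p-algebra) is an algebra $(A;\wedge,\vee,\neg,D,0,1)$ of type $(2,2,1,1,0,0)$ such that $(A;\wedge,\vee,0,1)$ is a bounded distributive lattice; for every $a\in A$, $\neg a$ is the greatest $b\in A$ with $a\wedge b=0$; and for every $a\in A$, $Da$ is the smallest $b\in A$ with $a\vee b=1$. It is regular if $a\wedge Da\le b\vee\neg b$ for all $a,b\in A$. A three-valued dp-algebra is a regular dp-algebra satisfying $\neg x\vee\neg\neg x=1$ and $Dx\wedge DDx=0$. A c3dp-algebra (centred three-valued dp-algebra) is an algebra $(A;\wedge,\vee,\neg,D,0,c,1)$ such that $(A;\wedge,\vee,\neg,D,0,1)$ is a three-valued dp-algebra and the constant $c$ satisfies $\neg c=0$ and $Dc=1$. -}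

module Defs where

open import Level using (Level; _⊔_)
open import Data.Product.Base using (_×_; _,_; proj₁; Σ-syntax)
open import Data.Product.Relation.Binary.Pointwise.NonDependent using (Pointwise)
open import Function.Base using (_on_; flip)
open import Algebra.Core using (Op₁; Op₂)
open import Algebra.Definitions using (Congruent₁)
open import Algebra.Lattice.Bundles using (BooleanAlgebra)
open import Algebra.Lattice.Structures using (IsDistributiveLattice)
import Algebra.Lattice.Properties.BooleanAlgebra as BooleanAlgebraProperties
open import Relation.Binary.Core using (Rel)
open import Relation.Binary.Definitions using (Minimum; Maximum)
import Relation.Binary.Construct.NaturalOrder.Left as NaturalOrder
import Relation.Binary.Reasoning.Setoid as SetoidReasoning
open import Relation.Unary using (Pred)

IsGreatest : ∀ {a ℓ p} {A : Set a} → Rel A ℓ → Pred A p → Pred A (a ⊔ ℓ ⊔ p)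
IsGreatest _≤_ P m = P m × (∀ x → P x → x ≤ m)

IsLeast : ∀ {a ℓ p} {A : Set a} → Rel A ℓ → Pred A p → Pred A (a ⊔ ℓ ⊔ p)
IsLeast _≤_ = IsGreatest (flip _≤_)

-- Operations are listed in the order (∧, ∨, ¬, D, 0, c, 1); note that the
-- library's lattice structures take ∨ before ∧.

module _ {a ℓ : Level} {A : Set a} (_≈_ : Rel A ℓ) where

  -- The order is the natural one, x ≤ y iff x ≈ x ∧ y.

  record IsBoundedDistributiveLattice (_∧_ _∨_ : Op₂ A) (0# 1# : A)
         : Set (a ⊔ ℓ) where
    open NaturalOrder _≈_ _∧_ using (_≤_)
    field
      isDistributiveLattice : IsDistributiveLattice _≈_ _∨_ _∧_
      minimum               : Minimum _≤_ 0#
      maximum               : Maximum _≤_ 1#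

  -- The congruence fields say that ¬ and D are operations on the setoid (A , ≈).

  record IsDPAlgebra (_∧_ _∨_ : Op₂ A) (¬_ D : Op₁ A) (0# 1# : A)
         : Set (a ⊔ ℓ) where
    open NaturalOrder _≈_ _∧_ using (_≤_)
    field
      isBoundedDistributiveLattice : IsBoundedDistributiveLattice _∧_ _∨_ 0# 1#
      ¬-cong           : Congruent₁ _≈_ ¬_
      D-cong           : Congruent₁ _≈_ D
      pseudocomplement : ∀ x → IsGreatest _≤_ (λ y → (x ∧ y) ≈ 0#) (¬ x)
      dual-pseudocomplement : ∀ x → IsLeast _≤_ (λ y → (x ∨ y) ≈ 1#) (D x)

  record IsRegularDPAlgebra (_∧_ _∨_ : Op₂ A) (¬_ D : Op₁ A) (0# 1# : A)
         : Set (a ⊔ ℓ) where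
    open NaturalOrder _≈_ _∧_ using (_≤_)
    field
      isDPAlgebra : IsDPAlgebra _∧_ _∨_ ¬_ D 0# 1#
      regular     : ∀ x y → (x ∧ D x) ≤ (y ∨ (¬ y))

  record IsThreeValuedDPAlgebra (_∧_ _∨_ : Op₂ A) (¬_ D : Op₁ A) (0# 1# : A)
         : Set (a ⊔ ℓ) where
    field
      isRegularDPAlgebra : IsRegularDPAlgebra _∧_ _∨_ ¬_ D 0# 1#
      stone              : ∀ x → ((¬ x) ∨ (¬ (¬ x))) ≈ 1#
      dual-stone         : ∀ x → (D x ∧ D (D x)) ≈ 0#

  record IsC3DPAlgebra (_∧_ _∨_ : Op₂ A) (¬_ D : Op₁ A) (0# c 1# : A)
         : Set (a ⊔ ℓ) where
    field
      isThreeValuedDPAlgebra : IsThreeValuedDPAlgebra _∧_ _∨_ ¬_ D 0# 1#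
      ¬c≈0                   : (¬ c) ≈ 0#
      Dc≈1                   : D c ≈ 1#

module ContractAlgebra {b ℓ : Level} (B : BooleanAlgebra b ℓ) where

  open BooleanAlgebra B
    renaming ( Carrier to |B| ; _≈_ to _≈ᴮ_ ; _∨_ to _∪_ ; _∧_ to _∩_
             ; ¬_ to infix 8 _′ ; ⊤ to 1ᴮ ; ⊥ to 0ᴮ )
  open BooleanAlgebraProperties B
    using (∨-identityʳ; ∨-identityˡ; ∨-zeroʳ; ∨-zeroˡ; ∧-identityʳ)
  open SetoidReasoning setoid

  private
    ∪-∩-cover : ∀ {x y z w} → x ∪ z ≈ᴮ 1ᴮ → y ∪ w ≈ᴮ 1ᴮ →
                (x ∪ y) ∪ (z ∩ w) ≈ᴮ 1ᴮ
    ∪-∩-cover {x} {y} {z} {w} p q = begin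
      (x ∪ y) ∪ (z ∩ w)              ≈⟨ ∨-distribˡ-∧ _ _ _ ⟩
      ((x ∪ y) ∪ z) ∩ ((x ∪ y) ∪ w)  ≈⟨ ∧-congʳ (∨-congʳ (∨-comm x y)) ⟩
      ((y ∪ x) ∪ z) ∩ ((x ∪ y) ∪ w)  ≈⟨ ∧-cong (∨-assoc y x z) (∨-assoc x y w) ⟩
      (y ∪ (x ∪ z)) ∩ (x ∪ (y ∪ w))  ≈⟨ ∧-cong (∨-congˡ p) (∨-congˡ q) ⟩
      (y ∪ 1ᴮ) ∩ (x ∪ 1ᴮ)            ≈⟨ ∧-cong (∨-zeroʳ y) (∨-zeroʳ x) ⟩
      1ᴮ ∩ 1ᴮ                        ≈⟨ ∧-identityʳ 1ᴮ ⟩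
      1ᴮ                             ∎

    ∩-∪-cover : ∀ {x y z w} → x ∪ z ≈ᴮ 1ᴮ → y ∪ w ≈ᴮ 1ᴮ →
                (x ∩ y) ∪ (z ∪ w) ≈ᴮ 1ᴮ
    ∩-∪-cover p q =
      trans (∨-comm _ _) (∪-∩-cover (trans (∨-comm _ _) p) (trans (∨-comm _ _) q))

  Contract : Set (b ⊔ ℓ)
  Contract = Σ[ (x , y) ∈ |B| × |B| ] (x ∪ y ≈ᴮ 1ᴮ)

  -- Contracts are equal when their underlying pairs are; the proof that the
  -- pair covers 1 is disregarded.
  infix 4 _≈_
  _≈_ : Rel Contract ℓ
  _≈_ = Pointwise _≈ᴮ_ _≈ᴮ_ on proj₁

  infixr 7 _∧_
  _∧_ : Op₂ Contract
  ((x , y) , p) ∧ ((z , w) , q) = (x ∪ z , y ∩ w) , ∪-∩-cover p q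

  infixr 6 _∨_
  _∨_ : Op₂ Contract
  ((x , y) , p) ∨ ((z , w) , q) = (x ∩ z , y ∪ w) , ∩-∪-cover p q

  infix 8 ¬_
  ¬_ : Op₁ Contract
  ¬ ((x , y) , _) = (y , y ′) , ∨-complementʳ y

  D : Op₁ Contract
  D ((x , y) , _) = (x ′ , x) , ∨-complementˡ x

  ⊥ γ ⊤ : Contract
  ⊥ = (1ᴮ , 0ᴮ) , ∨-identityʳ 1ᴮ
  γ = (1ᴮ , 1ᴮ) , ∨-zeroʳ 1ᴮ
  ⊤ = (0ᴮ , 1ᴮ) , ∨-identityˡ 1ᴮ

{-# OPTIONS --safe #-}
module Submission where

open import Defs
open import Algebra.Lattice.Bundles using (BooleanAlgebra)
open import Algebra.Lattice.Structures using (IsDistributiveLattice)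
import Algebra.Lattice.Properties.BooleanAlgebra as BooleanAlgebraProperties
open import Data.Product.Base using (_,_; proj₁)
open import Data.Product.Relation.Binary.Pointwise.NonDependent using (×-isEquivalence)
import Relation.Binary.Construct.On as On
import Relation.Binary.Reasoning.Setoid as SetoidReasoning

-- Contracts form a sublattice of the product of the dual of `B` with `B`, so `(a , b) ≤ (c , d)`
-- means that `c` lies below `a` and `b` below `d`, and every lattice law is a Boolean law paired
-- with its dual. What is not componentwise is the extremality of `¬` and `D`: there
-- `disjoint-cover⇒≤` turns disjointness and covering into inequalities in `B`. The remaining axioms
-- reduce to complement laws, because each value of `¬` or `D` is a pair of complementary elements,
-- and `γ` is `(1 , 1)`.

module BooleanOrder {b ℓ} (B : BooleanAlgebra b ℓ) where
  open BooleanAlgebra B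
  open BooleanAlgebraProperties B
  open SetoidReasoning setoid

  -- Split `x` along the cover `y ∨ z`: the part inside `y` vanishes, so all of `x` lies in `z`.
  disjoint-cover⇒≤ : ∀ {x y z} → x ∧ y ≈ ⊥ → y ∨ z ≈ ⊤ → x ≈ x ∧ z
  disjoint-cover⇒≤ {x} {y} {z} p q = begin
    x                ≈⟨ ∧-identityʳ x ⟨
    x ∧ ⊤            ≈⟨ ∧-congˡ q ⟨
    x ∧ (y ∨ z)      ≈⟨ ∧-distribˡ-∨ x y z ⟩
    x ∧ y ∨ x ∧ z    ≈⟨ ∨-congʳ p ⟩
    ⊥ ∨ x ∧ z        ≈⟨ ∨-identityˡ _ ⟩
    x ∧ z            ∎

  -- The first coordinate of a contract carries the reversed order, with join acting as meet, so
  -- inequalities there are needed in join form.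
  ≤-meet⇒join : ∀ {x y} → x ≈ x ∧ y → y ≈ y ∨ x
  ≤-meet⇒join {x} {y} p = begin
    y            ≈⟨ ∨-absorbs-∧ y x ⟨
    y ∨ y ∧ x    ≈⟨ ∨-congˡ (∧-comm y x) ⟩
    y ∨ x ∧ y    ≈⟨ ∨-congˡ p ⟨
    y ∨ x        ∎

module ContractLattice {b ℓ} (B : BooleanAlgebra b ℓ) where
  open ContractAlgebra B
  private module B = BooleanAlgebra B

  isDistributiveLattice : IsDistributiveLattice _≈_ _∨_ _∧_
  isDistributiveLattice = record
    { isLattice = record
      { isEquivalence = On.isEquivalence proj₁ (×-isEquivalence B.isEquivalence B.isEquivalence)
      ; ∨-comm        = λ _ _ → B.∧-comm _ _ , B.∨-comm _ _
      ; ∨-assoc       = λ _ _ _ → B.∧-assoc _ _ _ , B.∨-assoc _ _ _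
      ; ∨-cong        = λ (p , q) (r , s) → B.∧-cong p r , B.∨-cong q s
      ; ∧-comm        = λ _ _ → B.∨-comm _ _ , B.∧-comm _ _
      ; ∧-assoc       = λ _ _ _ → B.∨-assoc _ _ _ , B.∧-assoc _ _ _
      ; ∧-cong        = λ (p , q) (r , s) → B.∨-cong p r , B.∧-cong q s
      ; absorptive    = (λ _ _ → B.∧-absorbs-∨ _ _ , B.∨-absorbs-∧ _ _)
                      , (λ _ _ → B.∨-absorbs-∧ _ _ , B.∧-absorbs-∨ _ _)
      }
    ; ∨-distrib-∧ = (λ _ _ _ → B.∧-distribˡ-∨ _ _ _ , B.∨-distribˡ-∧ _ _ _)
                  , (λ _ _ _ → B.∧-distribʳ-∨ _ _ _ , B.∨-distribʳ-∧ _ _ _)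
    ; ∧-distrib-∨ = (λ _ _ _ → B.∨-distribˡ-∧ _ _ _ , B.∧-distribˡ-∨ _ _ _)
                  , (λ _ _ _ → B.∨-distribʳ-∧ _ _ _ , B.∧-distribʳ-∨ _ _ _)
    }

  open BooleanAlgebraProperties B
  open BooleanOrder B

  isBoundedDistributiveLattice : IsBoundedDistributiveLattice _≈_ _∧_ _∨_ ⊥ ⊤
  isBoundedDistributiveLattice = record
    { isDistributiveLattice = isDistributiveLattice
    ; minimum = λ _ → B.sym (∨-zeroˡ _) , B.sym (∧-zeroˡ _)
    ; maximum = λ _ → B.sym (∨-identityʳ _) , B.sym (∧-identityʳ _)
    }

  -- The covering condition c ∪ d = 1 of the competitor (c , d) is what bounds
  -- the component that the defining equation of ¬ or D leaves free.
  isDPAlgebra : IsDPAlgebra _≈_ _∧_ _∨_ ¬_ D ⊥ ⊤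
  isDPAlgebra = record
    { isBoundedDistributiveLattice = isBoundedDistributiveLattice
    ; ¬-cong = λ (_ , q) → q , B.¬-cong q
    ; D-cong = λ (p , _) → B.¬-cong p , p
    ; pseudocomplement = λ ((_ , b) , cover) →
        (cover , B.∧-complementʳ b) ,
        λ (_ , cover′) (_ , b∩d≈0) →
          ≤-meet⇒join (disjoint-cover⇒≤ b∩d≈0 (B.trans (B.∨-comm _ _) cover′)) ,
          disjoint-cover⇒≤ (B.trans (B.∧-comm _ _) b∩d≈0) (B.∨-complementʳ b)
    ; dual-pseudocomplement = λ ((a , _) , cover) →
        (B.∧-complementʳ a , B.trans (B.∨-comm _ _) cover) ,
        λ (_ , cover′) (a∩c≈0 , _) →
          ≤-meet⇒join (disjoint-cover⇒≤ (B.trans (B.∧-comm _ _) a∩c≈0) (B.∨-complementʳ a)) ,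
          disjoint-cover⇒≤ a∩c≈0 cover′
    }

  -- The centre `γ` separates the two sides: `x ∧ D x` has first coordinate 1, hence lies below `γ`,
  -- while `y ∨ ¬ y` has second coordinate 1, hence lies above it.
  isRegularDPAlgebra : IsRegularDPAlgebra _≈_ _∧_ _∨_ ¬_ D ⊥ ⊤
  isRegularDPAlgebra = record
    { isDPAlgebra = isDPAlgebra
    ; regular = λ ((a , _) , _) ((_ , d) , _) →
        B.trans (B.∨-complementʳ a)
          (B.sym (B.trans (B.∨-congʳ (B.∨-complementʳ a)) (∨-zeroˡ _))) ,
        B.sym (B.trans (B.∧-congˡ (B.∨-complementʳ d)) (∧-identityʳ _))
    }

  isThreeValuedDPAlgebra : IsThreeValuedDPAlgebra _≈_ _∧_ _∨_ ¬_ D ⊥ ⊤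
  isThreeValuedDPAlgebra = record
    { isRegularDPAlgebra = isRegularDPAlgebra
    -- For `x = (a , b)`, `¬ ¬ x` is `(b ′ , b ′ ′)`, so the complement laws are used at `b` and at
    -- `b ′`; dually for `D` with `a`.
    ; stone      = λ _ → B.∧-complementʳ _ , B.∨-complementʳ _
    ; dual-stone = λ _ → B.∨-complementʳ _ , B.∧-complementʳ _
    }

  isC3DPAlgebra : IsC3DPAlgebra _≈_ _∧_ _∨_ ¬_ D ⊥ γ ⊤
  isC3DPAlgebra = record
    { isThreeValuedDPAlgebra = isThreeValuedDPAlgebra
    ; ¬c≈0 = B.refl , ¬⊤≈⊥
    ; Dc≈1 = ¬⊤≈⊥ , B.refl
    }

proposition3p3 : ∀ {b ℓ} (B : BooleanAlgebra b ℓ) →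
    let open ContractAlgebra B in
    IsC3DPAlgebra _≈_ _∧_ _∨_ ¬_ D ⊥ γ ⊤
proposition3p3 B = ContractLattice.isC3DPAlgebra B
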